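{- Let $G$ be a countable group and let $A\subseteq G$. The following statements are equivalent: (i) $A$ is asymptotically scattered; (ii) $A$ is sparse, i.e. for every infinite subset $Y$ of $G$ there exists a finite subset $F\subset Y$ such that $\bigcap_{g\in F}gA$ is finite; (iii) for each free ultrafilter $\mathcal{U}$ on $G$ with $A\in\mathcal{U}$, the set $\{g\in G:A\in g\,\mathcal{U}\}$ is finite, where $g\,\mathcal{U}=\{gU:U\in\mathcal{U}\}$.
   Context: The group $G$ is considered with the ball structure whose radii are the finite subsets $F$ of $G$ and whose balls are $B(g,F)=Fg\cup\{g\}$ for $g\in G$. On a subset $A\subseteq G$ one takes the induced balls $B_A(a,F)=A\cap B(a,F)$, $a\in A$. A subset of $A$ is bounded if it is contained in some ball $B_A(a,F)$ (equivalently, apart from the trivial empty case, if it is finite). For radii $F,H$ write $F<H$ (relative to $A$) if $B_A(a,F)\subseteq B_A(a,H)$ for every $a\in A$. A subset $Y\subseteq A$ has asymptotically isolated balls in $A$ if there is a finite $F\subseteq G$ such that for every finite $H\subseteq G$ with $F<H$ there exists $y\in Y$ with $B_A(y,H)\setminus B_A(y,F)=\varnothing$. The subset $A$ is asymptotically scattered if each unbounded subset $Y\subseteq A$ has asymptotically isolated balls in $A$. -}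

module Defs where

open import Algebra.Bundles using (Group)
open import Data.List.Base using (List)
import Data.List.Membership.Setoid as Membership
open import Data.Nat.Base using (ℕ)
open import Data.Product.Base using (Σ; ∃; _×_; _,_)
open import Data.Sum.Base using (_⊎_)
open import Function.Base using (_∘_)
open import Function.Bundles using (Surjection)
open import Level using (Level; _⊔_) renaming (suc to lsuc)
open import Relation.Binary.Bundles using (Setoid)
open import Relation.Binary.Definitions using (_Respects_)
open import Relation.Binary.PropositionalEquality.Properties using () renaming (setoid to ≡-setoid)
open import Relation.Nullary.Negation.Core using (¬_)
open import Relation.Unary using (Pred; _∈_; _⊆_; _≐_; _∩_; _∪_; _∖_; ∁; Empty)
open import Relation.Unary.Polymorphic using (U; ∅)

private
  variable
    c ℓ p : Level

module _ (S : Setoid c ℓ) where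
  open Setoid S

  -- The subsets of a setoid are the predicates that respect its equality.
  record Subset : Set (lsuc (c ⊔ ℓ)) where
    field
      pred : Pred Carrier (c ⊔ ℓ)
      resp : pred Respects _≈_

  Family : Set (lsuc (lsuc (c ⊔ ℓ)))
  Family = Pred Subset (lsuc (c ⊔ ℓ))

  Finite : Pred Carrier p → Set (c ⊔ ℓ ⊔ p)
  Finite P = ∃ λ (xs : List Carrier) → P ≐ (λ x → Membership._∈_ S x xs)

  Infinite : Pred Carrier p → Set (c ⊔ ℓ ⊔ p)
  Infinite P = ¬ Finite P

  -- The carrier has to be inhabited, as it is in a group; finite setoids are
  -- included.
  Countable : Set (c ⊔ ℓ)
  Countable = Surjection (≡-setoid ℕ) S

open Subset public

module _ {S : Setoid c ℓ} where
  open Setoid S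

  fullˢ : Subset S
  fullˢ .pred     = U
  fullˢ .resp _ u = u

  emptyˢ : Subset S
  emptyˢ .pred      = ∅
  emptyˢ .resp _ ()

  infixr 7 _∩ˢ_
  _∩ˢ_ : Subset S → Subset S → Subset S
  (P ∩ˢ Q) .pred               = pred P ∩ pred Q
  (P ∩ˢ Q) .resp x≈y (px , qx) = resp P x≈y px , resp Q x≈y qx

  ∁ˢ : Subset S → Subset S
  ∁ˢ P .pred         = ∁ (pred P)
  ∁ˢ P .resp x≈y ¬px = ¬px ∘ resp P (sym x≈y)

  record IsFilter (𝓕 : Family S) : Set (lsuc (c ⊔ ℓ)) where
    field
      full     : fullˢ ∈ 𝓕
      proper   : ¬ (emptyˢ ∈ 𝓕)
      upward   : ∀ {P Q} → pred P ⊆ pred Q → P ∈ 𝓕 → Q ∈ 𝓕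
      ∩-closed : ∀ {P Q} → P ∈ 𝓕 → Q ∈ 𝓕 → P ∩ˢ Q ∈ 𝓕

  record IsUltrafilter (𝓤 : Family S) : Set (lsuc (c ⊔ ℓ)) where
    field
      isFilter : IsFilter 𝓤
      ultra    : ∀ P → P ∈ 𝓤 ⊎ ∁ˢ P ∈ 𝓤

    open IsFilter isFilter public

  -- The members of 𝓤 have empty intersection.
  Free : Family S → Set (lsuc (c ⊔ ℓ))
  Free 𝓤 = Empty (λ x → ∀ P → P ∈ 𝓤 → x ∈ pred P)

-- A consequence of the axiom of choice, to be assumed explicitly.  Without
-- some such principle there may be no free ultrafilters at all.
UltrafilterLemma : ∀ c ℓ → Set (lsuc (lsuc (c ⊔ ℓ)))
UltrafilterLemma c ℓ =
  (S : Setoid c ℓ) (𝓕 : Family S) → IsFilter 𝓕 →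
  Σ (Family S) λ 𝓤 → IsUltrafilter 𝓤 × 𝓕 ⊆ 𝓤

module _ (G : Group c ℓ) where
  open Group G

  leftTranslate : Carrier → Pred Carrier (c ⊔ ℓ) → Pred Carrier (c ⊔ ℓ)
  leftTranslate g P x = ∃ λ a → a ∈ P × x ≈ g ∙ a

  rightTranslate : Pred Carrier (c ⊔ ℓ) → Carrier → Pred Carrier (c ⊔ ℓ)
  rightTranslate P g x = ∃ λ a → a ∈ P × x ≈ a ∙ g

  translateFamily : Carrier → Family setoid → Family setoid
  translateFamily g 𝓤 P = ∃ λ Q → Q ∈ 𝓤 × pred P ≐ leftTranslate g (pred Q)

  Radius : Set (lsuc (c ⊔ ℓ))
  Radius = Σ (Subset setoid) λ F → Finite setoid (pred F)

  ball : Carrier → Radius → Pred Carrier (c ⊔ ℓ)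
  ball g (F , _) = rightTranslate (pred F) g ∪ (_≈ g)

  module _ (A : Subset setoid) where

    inducedBall : Carrier → Radius → Pred Carrier (c ⊔ ℓ)
    inducedBall a F = pred A ∩ ball a F

    RadiusLess : Radius → Radius → Set (c ⊔ ℓ)
    RadiusLess F H = ∀ a → a ∈ pred A → inducedBall a F ⊆ inducedBall a H

    -- The empty set counts as bounded.  This needs to be said only for A = ∅,
    -- where there are no balls.
    Bounded : Subset setoid → Set (lsuc (c ⊔ ℓ))
    Bounded Y =
      Empty (pred Y) ⊎
      (∃ λ a → a ∈ pred A × Σ Radius λ F → pred Y ⊆ inducedBall a F)

    HasAsymptoticallyIsolatedBalls : Subset setoid → Set (lsuc (c ⊔ ℓ))
    HasAsymptoticallyIsolatedBalls Y =
      Σ Radius λ F → ∀ (H : Radius) → RadiusLess F H →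
      ∃ λ y → y ∈ pred Y × Empty (inducedBall y H ∖ inducedBall y F)

    AsymptoticallyScattered : Set (lsuc (c ⊔ ℓ))
    AsymptoticallyScattered =
      ∀ (Y : Subset setoid) → pred Y ⊆ pred A → ¬ Bounded Y →
      HasAsymptoticallyIsolatedBalls Y

    Sparse : Set (lsuc (c ⊔ ℓ))
    Sparse =
      ∀ (Y : Subset setoid) → Infinite setoid (pred Y) →
      Σ (Subset setoid) λ F → Finite setoid (pred F) × pred F ⊆ pred Y ×
      Finite setoid (λ x → ∀ g → g ∈ pred F → x ∈ leftTranslate g (pred A))

    FinitelyManyTranslatesContain : Set (lsuc (lsuc (c ⊔ ℓ)))
    FinitelyManyTranslatesContain =
      ∀ (𝓤 : Family setoid) → IsUltrafilter 𝓤 → Free 𝓤 → A ∈ 𝓤 →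
      Finite setoid (λ g → A ∈ translateFamily g 𝓤)

{-# OPTIONS --safe #-}

-- Go round the cycle (i) ⇒ (ii) ⇒ (iii) ⇒ (i), reading A ∈ h𝓤 as {x | hx ∈ A} ∈ 𝓤.
--
-- (i) ⇒ (ii): let Y be infinite with ⋂_{g∈F} gA infinite for all finite F ⊆ Y, let
-- e enumerate G and let g₀ ∈ Y.  Choose xₙ outside {e₀, …, eₙ} and in gA for
-- all g ∈ Y ∩ {g₀, e₀, …, eₙ}.  Then Z = {g₀⁻¹xₙ | n} ⊆ A is unbounded, and it
-- has no isolated balls: given F, some g ∈ Y has h = g⁻¹g₀ ∉ F ∪ {1}, and
-- hz ∈ A for all but finitely many z ∈ Z.
--
-- (ii) ⇒ (iii): finite subsets of {g | gA ∈ 𝓤} have ⋂ gA ∈ 𝓤, which is infinite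
-- as 𝓤 is free.
--
-- (iii) ⇒ (i): extend the cofinite filter on Y ⊆ A to an ultrafilter 𝓤.  The
-- finite set F = {h | A ∈ h𝓤} is a radius witnessing isolated balls: otherwise,
-- for some finite H, every y ∈ Y has some h ∈ H ∖ F with hy ∈ A, so that
-- {y | hy ∈ A} ∈ 𝓤 for one h ∈ H ∖ F.
module Submission where

open import Defs
open import Algebra.Bundles using (Group)
import Algebra.Properties.Group as GroupProperties
open import Axiom.ExcludedMiddle using (ExcludedMiddle)
open import Data.Empty using (⊥-elim)
open import Data.List.Base using (List; []; _∷_; _++_; map; filter; applyUpTo)
open import Data.List.Extrema.Nat using (max; xs≤max)
import Data.List.Membership.Setoid as Membership
import Data.List.Membership.Setoid.Properties as Membershipₚ
open import Data.List.Relation.Unary.All as All using (All; []; _∷_)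
import Data.List.Relation.Unary.All.Properties as Allₚ
open import Data.List.Relation.Unary.Any as Any using (Any; here; there)
open import Data.List.Relation.Unary.Any.Properties using (¬Any[])
open import Data.Nat.Base using (ℕ; s≤s; _≤_; _<_) renaming (suc to sucℕ)
open import Data.Nat.Properties using (<-≤-connex)
open import Data.Product.Base using (∃; _×_; _,_; proj₁; proj₂)
open import Data.Sum.Base using (inj₁; inj₂; _⊎_; [_,_]′)
open import Function.Base using (_∘_; id)
open import Function.Bundles using (_⇔_; mk⇔; module Surjection)
open import Level using (Level; Lift; lift; lower; _⊔_; suc)
open import Relation.Binary.Bundles using (Setoid)
open import Relation.Binary.Definitions using (_Respects_)
import Relation.Binary.Reasoning.Setoid as ≈-Reasoning
open import Relation.Nullary.Decidable using (Dec; yes; no; map′; True; toWitness; fromWitness; decidable-stable)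
open import Relation.Nullary.Negation using (¬_)
open import Relation.Unary using (Pred; Decidable; _∈_; _∉_; _⊆_; _∖_; Empty)

private
  variable
    c ℓ p : Level

lower-excludedMiddle : ∀ a {b} → ExcludedMiddle (a ⊔ b) → ExcludedMiddle b
lower-excludedMiddle a em {P} = map′ lower lift (em {Lift a P})

-- Finite and infinite subsets.

module _ {S : Setoid c ℓ} where
  open Setoid S
  open Membership S using () renaming (_∈_ to _∈ₗ_; _∉_ to _∉ₗ_)

  listˢ : List Carrier → Subset S
  listˢ xs .pred x = x ∈ₗ xs
  listˢ xs .resp   = Membershipₚ.∈-resp-≈ S

  finite-listˢ : ∀ xs → Finite S (pred (listˢ xs))
  finite-listˢ xs = xs , id , id

  ⋂ˢ : (Carrier → Subset S) → List Carrier → Subset S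
  ⋂ˢ Q is .pred x   = All (λ i → x ∈ pred (Q i)) is
  ⋂ˢ Q is .resp x≈y = All.map (λ {i} → resp (Q i) x≈y)

  -- `Finite` asks for a list of exactly the elements of `P`, so a list that only covers `P` is
  -- filtered.
  decidable-⊆-finite : ∀ {P : Pred Carrier p} → Decidable P → P Respects _≈_ →
                       ∀ {xs} → P ⊆ (_∈ₗ xs) → Finite S P
  decidable-⊆-finite P? P-resp {xs} P⊆xs =
    filter P? xs ,
    (λ x∈P → Membershipₚ.∈-filter⁺ S P? P-resp (P⊆xs x∈P) x∈P) ,
    (λ x∈f → proj₂ (Membershipₚ.∈-filter⁻ S P? P-resp {xs = xs} x∈f))

  infinite⇒∃∉ : ExcludedMiddle (c ⊔ ℓ) → (P : Subset S) → Infinite S (pred P) →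
                ∀ xs → ∃ λ x → x ∈ pred P × x ∉ₗ xs
  infinite⇒∃∉ em P P-infinite xs = decidable-stable em λ ∄x →
    P-infinite (decidable-⊆-finite (λ _ → em) (resp P)
      λ {x} x∈P → decidable-stable em λ x∉xs → ∄x (x , x∈P , x∉xs))

  -- Filters and ultrafilters.

  module _ {𝓕 : Family S} (isFilter : IsFilter 𝓕) where
    open IsFilter isFilter

    ⋂-closed : ∀ Q is → All (λ i → Q i ∈ 𝓕) is → ⋂ˢ Q is ∈ 𝓕
    ⋂-closed Q []       []       = upward (λ _ → []) full
    ⋂-closed Q (i ∷ is) (q ∷ qs) =
      upward (λ (x , xs) → x ∷ xs) (∩-closed q (⋂-closed Q is qs))

  module _ {𝓤 : Family S} (isUltrafilter : IsUltrafilter 𝓤) where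
    open IsUltrafilter isUltrafilter

    -- If `Q i` is not in `𝓤`, then `P` can be cut down to its part outside `Q i`, which the
    -- remaining sets cover. Once the list is exhausted, `P` would be empty.
    ⋃-prime : ∀ (Q : Carrier → Subset S) is {P} → P ∈ 𝓤 →
              (∀ {x} → x ∈ pred P → Any (λ i → x ∈ pred (Q i)) is) →
              Any (λ i → Q i ∈ 𝓤) is
    ⋃-prime Q [] P∈𝓤 P⊆⋃ =
      ⊥-elim (proper (upward (λ x∈P → ⊥-elim (¬Any[] (P⊆⋃ x∈P))) P∈𝓤))
    ⋃-prime Q (i ∷ is) P∈𝓤 P⊆⋃ with ultra (Q i)
    ... | inj₁ Qi∈𝓤  = here Qi∈𝓤
    ... | inj₂ ∁Qi∈𝓤 = there (⋃-prime Q is (∩-closed P∈𝓤 ∁Qi∈𝓤)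
            λ (x∈P , x∉Qi) → Any.tail x∉Qi (P⊆⋃ x∈P))

    -- A finite member is a union of singletons, so some singleton of `x` is in `𝓤`. Any member must
    -- meet it, so `x` lies in all members.
    free⇒∌finite : ExcludedMiddle (c ⊔ ℓ) → Free 𝓤 →
                   ∀ {P} → P ∈ 𝓤 → ¬ Finite S (pred P)
    free⇒∌finite em free P∈𝓤 (xs , P⊆xs , _)
      with Any.satisfied (⋃-prime (λ x → listˢ (x ∷ [])) xs P∈𝓤
                            (Any.map here ∘ P⊆xs))
    ... | x , [x]∈𝓤 = free x λ R R∈𝓤 → decidable-stable em λ x∉R →
      proper (upward (λ { (y∈R , here y≈x) → ⊥-elim (x∉R (resp R y≈x y∈R)) })
                (∩-closed R∈𝓤 [x]∈𝓤))

  -- The sets containing all but finitely many points of `Y`. The `Lift` meets the universe level of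
  -- `Family`.
  cofiniteOn : Subset S → Family S
  cofiniteOn Y P = Lift (suc (c ⊔ ℓ)) (∃ λ xs → ∀ {y} → y ∈ pred Y → y ∈ₗ xs ⊎ y ∈ pred P)

  cofiniteOn-isFilter : (Y : Subset S) → (∀ xs → ¬ (pred Y ⊆ (_∈ₗ xs))) →
                        IsFilter (cofiniteOn Y)
  cofiniteOn-isFilter Y Y⊈ = record
    { full     = lift ([] , λ _ → inj₂ _)
    ; proper   = λ (lift (xs , Y⊆xs)) → Y⊈ xs ([ id , (λ ()) ]′ ∘ Y⊆xs)
    ; upward   = λ P⊆Q (lift (xs , Y⊆)) →
                   lift (xs , λ y∈Y → [ inj₁ , inj₂ ∘ P⊆Q ]′ (Y⊆ y∈Y))
    ; ∩-closed = λ (lift (xs , Y⊆P)) (lift (ys , Y⊆Q)) →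
                   lift (xs ++ ys , λ y∈Y → both xs (Y⊆P y∈Y) (Y⊆Q y∈Y))
    }
    where
    both : ∀ xs {ys y} {B C : Set (c ⊔ ℓ)} →
           y ∈ₗ xs ⊎ B → y ∈ₗ ys ⊎ C → y ∈ₗ xs ++ ys ⊎ B × C
    both xs (inj₁ y∈xs) _           = inj₁ (Membershipₚ.∈-++⁺ˡ S y∈xs)
    both xs (inj₂ _)    (inj₁ y∈ys) = inj₁ (Membershipₚ.∈-++⁺ʳ S xs y∈ys)
    both xs (inj₂ b)    (inj₂ c)    = inj₂ (b , c)

  ⊇cofiniteOn⇒free : ExcludedMiddle (c ⊔ ℓ) → ∀ Y {𝓤} → IsFilter 𝓤 →
                     cofiniteOn Y ⊆ 𝓤 → Free 𝓤
  ⊇cofiniteOn⇒free em Y isFilter cofinite⊆𝓤 x x∈⋂ =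
    -- The complement of a singleton is cofinite on any `Y`.
    x∈⋂ (∁ˢ (listˢ (x ∷ []))) (cofinite⊆𝓤 (lift (x ∷ [] , λ _ → dec em))) (here refl)
    where
    dec : {B : Set (c ⊔ ℓ)} → Dec B → B ⊎ ¬ B
    dec (yes b) = inj₁ b
    dec (no ¬b) = inj₂ ¬b

  -- Enumerations of a countable setoid.

  module _ (countable : Countable S) where
    open Surjection countable using () renaming (to to enum; to⁻ to index; to∘to⁻ to enum-index)

    ∈-enum : ∀ {x n} → index x < n → x ∈ₗ applyUpTo enum n
    ∈-enum i<n = Membershipₚ.∈-resp-≈ S (enum-index _) (Membershipₚ.∈-applyUpTo⁺ S enum i<n)

    list⊆enum : ∀ xs → ∃ λ n → ∀ {x} → x ∈ₗ xs → x ∈ₗ applyUpTo enum (sucℕ n)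
    list⊆enum xs = n , All.lookupₛ S (Membershipₚ.∈-resp-≈ S)
      (All.map (λ i≤n → ∈-enum (s≤s i≤n)) (Allₚ.map⁻ (xs≤max 0 (map index xs))))
      where
      n : ℕ
      n = max 0 (map index xs)

-- Translates, balls and bounded sets in a group.

module _ (G : Group c ℓ) where
  open Group G
  open GroupProperties G
  open Membership setoid using () renaming (_∈_ to _∈ₗ_; _∉_ to _∉ₗ_)

  ∈-map⁺ : ∀ {f : Carrier → Carrier} → (∀ {x y} → x ≈ y → f x ≈ f y) →
           ∀ {x xs} → x ∈ₗ xs → f x ∈ₗ map f xs
  ∈-map⁺ f-cong = Membershipₚ.∈-map⁺ setoid setoid f-cong

  listRadius : List Carrier → Radius G
  listRadius xs = listˢ xs , finite-listˢ {S = setoid} xs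

  -- This is the translate of `A` by `h ⁻¹`, in a form free of existential quantifiers.
  preimage : Carrier → Subset setoid → Subset setoid
  preimage h A .pred x   = h ∙ x ∈ pred A
  preimage h A .resp x≈y = resp A (∙-congˡ x≈y)

  preimage-cong : ∀ A {g h} → g ≈ h → pred (preimage g A) ⊆ pred (preimage h A)
  preimage-cong A g≈h = resp A (∙-congʳ g≈h)

  leftTranslate⇒preimage : ∀ A {g x} → x ∈ leftTranslate G g (pred A) → x ∈ pred (preimage (g ⁻¹) A)
  leftTranslate⇒preimage A {g} (a , a∈A , x≈ga) =
    resp A (trans (sym (\\-leftDividesʳ g a)) (∙-congˡ (sym x≈ga))) a∈A

  preimage⇒leftTranslate : ∀ A {g x} → x ∈ pred (preimage (g ⁻¹) A) → x ∈ leftTranslate G g (pred A)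
  preimage⇒leftTranslate A {g} {x} g⁻¹x∈A = g ⁻¹ ∙ x , g⁻¹x∈A , sym (\\-leftDividesˡ g x)

  -- The entry `ε` accounts for the centre `a`, which belongs to the ball whatever the radius.
  ball⇒∈-map : ∀ {a z} (F : Radius G) → z ∈ ball G a F →
               z ∈ₗ map (_∙ a) (ε ∷ proj₁ (proj₂ F))
  ball⇒∈-map (_ , fs , F⊆fs , _) (inj₁ (f , f∈F , z≈fa)) =
    there (Membershipₚ.∈-resp-≈ setoid (sym z≈fa) (∈-map⁺ ∙-congʳ (F⊆fs f∈F)))
  ball⇒∈-map _ (inj₂ z≈a) = here (trans z≈a (sym (identityˡ _)))

  ∈-map⇒∈ : ∀ h y {xs} → h ∙ y ∈ₗ map (_∙ y) xs → h ∈ₗ xs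
  ∈-map⇒∈ h y hy∈ with Membershipₚ.∈-map⁻ setoid setoid hy∈
  ... | x , x∈xs , hy≈xy = Membershipₚ.∈-resp-≈ setoid (sym (∙-cancelʳ y h x hy≈xy)) x∈xs

  module _ (A : Subset setoid) where

    -- Around any centre `a ∈ Y`, the quotients `y ∙ a ⁻¹` form a radius whose ball covers `Y`.
    list⊇⇒bounded : ExcludedMiddle (c ⊔ ℓ) → ∀ Y → pred Y ⊆ pred A →
                    ∀ {xs} → pred Y ⊆ (_∈ₗ xs) → Bounded G A Y
    list⊇⇒bounded em Y Y⊆A {xs} Y⊆xs with em {∃ (pred Y)}
    ... | no ∄y         = inj₁ λ y y∈Y → ∄y (y , y∈Y)
    ... | yes (a , a∈Y) = inj₂ (a , Y⊆A a∈Y , listRadius (map (_∙ a ⁻¹) xs) , λ {y} y∈Y →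
      Y⊆A y∈Y , inj₁ (y ∙ a ⁻¹ , ∈-map⁺ ∙-congʳ (Y⊆xs y∈Y) , sym (//-rightDividesˡ a y)))

    preimage∈⇒∈translateFamily : ∀ {𝓤 h} → preimage h A ∈ 𝓤 → A ∈ translateFamily G h 𝓤
    preimage∈⇒∈translateFamily {h = h} Q∈𝓤 =
      preimage h A , Q∈𝓤 ,
      (λ {x} x∈A → h ⁻¹ ∙ x , resp A (sym (\\-leftDividesˡ h x)) x∈A , sym (\\-leftDividesˡ h x)) ,
      (λ (a , ha∈A , x≈ha) → resp A (sym x≈ha) ha∈A)

    ∈translateFamily⇒preimage∈ : ∀ {𝓤 h} → IsFilter 𝓤 → A ∈ translateFamily G h 𝓤 → preimage h A ∈ 𝓤
    ∈translateFamily⇒preimage∈ isFilter (Q , Q∈𝓤 , _ , hQ⊆A) =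
      IsFilter.upward isFilter (λ {x} x∈Q → hQ⊆A (x , x∈Q , refl)) Q∈𝓤

    translates∩ : Subset setoid → Subset setoid
    translates∩ F .pred x = ∀ g → g ∈ pred F → x ∈ leftTranslate G g (pred A)
    translates∩ F .resp x≈y x∈⋂ g g∈F with x∈⋂ g g∈F
    ... | a , a∈A , x≈ga = a , a∈A , trans (sym x≈y) x≈ga

    module _ (EM : ExcludedMiddle (suc (c ⊔ ℓ))) where

      private
        em : ExcludedMiddle (c ⊔ ℓ)
        em = lower-excludedMiddle (suc (c ⊔ ℓ)) EM

      -- From scattered to sparse: an escaping sequence and its range.

      module _ (countable : Countable setoid)
               (Y : Subset setoid) (Y-infinite : Infinite setoid (pred Y))
        where
        open Surjection countable using () renaming (to to enum; to⁻ to index)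

        -- For `z n = g₀ ⁻¹ ∙ x n`, the last clause says that `x n` lies in the translate of `A` by
        -- `g` as soon as `g` has been enumerated.
        EscapingSequence : Carrier → (ℕ → Carrier) → Set (c ⊔ ℓ)
        EscapingSequence g₀ z =
          (∀ n → z n ∈ pred A) ×
          (∀ zs → ∃ λ n → z n ∉ₗ zs) ×
          (∀ {g} → g ∈ pred Y → ∀ {n} → index g ≤ n → (g ⁻¹ ∙ g₀) ∙ z n ∈ pred A)

        escapingSequence :
          (∀ F → Finite setoid (pred F) → pred F ⊆ pred Y → Infinite setoid (pred (translates∩ F))) →
          ∃ λ g₀ → ∃ (EscapingSequence g₀)
        escapingSequence ⋂-infinite = g₀ , z , z∈A , z-unbounded , g⁻¹g₀z∈A
          where
          g₀ : Carrier
          g₀ = proj₁ (infinite⇒∃∉ em Y Y-infinite [])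

          g₀∈Y : g₀ ∈ pred Y
          g₀∈Y = proj₁ (proj₂ (infinite⇒∃∉ em Y Y-infinite []))

          F : ℕ → Subset setoid
          -- Listing `g₀` separately puts every `z n` in `A`, including those with `n` below the
          -- index of `g₀`.
          F n = Y ∩ˢ listˢ (g₀ ∷ applyUpTo enum (sucℕ n))

          next : ∀ n → ∃ λ x → x ∈ pred (translates∩ (F n)) × x ∉ₗ applyUpTo enum (sucℕ n)
          next n = infinite⇒∃∉ em (translates∩ (F n))
            (⋂-infinite (F n) (decidable-⊆-finite {S = setoid} (λ _ → em) (resp (F n)) proj₂) proj₁)
            (applyUpTo enum (sucℕ n))

          x : ℕ → Carrier
          x n = proj₁ (next n)

          z : ℕ → Carrier
          z n = g₀ ⁻¹ ∙ x n

          z∈A : ∀ n → z n ∈ pred A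
          z∈A n = leftTranslate⇒preimage A (proj₁ (proj₂ (next n)) g₀ (g₀∈Y , here refl))

          z-unbounded : ∀ zs → ∃ λ n → z n ∉ₗ zs
          z-unbounded zs with list⊆enum countable (map (g₀ ∙_) zs)
          -- Were `z n` in `zs`, then `x n = g₀ ∙ z n` would be among the first enumerated elements,
          -- which it avoids.
          ... | n , ⊆enum = n , λ z∈zs → proj₂ (proj₂ (next n)) (⊆enum
            (Membershipₚ.∈-resp-≈ setoid (\\-leftDividesˡ g₀ (x n)) (∈-map⁺ ∙-congˡ z∈zs)))

          g⁻¹g₀z∈A : ∀ {g} → g ∈ pred Y → ∀ {n} → index g ≤ n → (g ⁻¹ ∙ g₀) ∙ z n ∈ pred A
          g⁻¹g₀z∈A {g} g∈Y {n} i≤n = resp A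
            (trans (∙-congˡ (sym (\\-leftDividesˡ g₀ (x n)))) (sym (assoc (g ⁻¹) g₀ (z n))))
            (leftTranslate⇒preimage A
              (proj₁ (proj₂ (next n)) g (g∈Y , there (∈-enum countable (s≤s i≤n)))))

        module SequenceRange {g₀ : Carrier} {z : ℕ → Carrier} (z-escaping : EscapingSequence g₀ z) where

          private
            z∈A : ∀ n → z n ∈ pred A
            z∈A = proj₁ z-escaping

            z-unbounded : ∀ zs → ∃ λ n → z n ∉ₗ zs
            z-unbounded = proj₁ (proj₂ z-escaping)

            g⁻¹g₀z∈A : ∀ {g} → g ∈ pred Y → ∀ {n} → index g ≤ n → (g ⁻¹ ∙ g₀) ∙ z n ∈ pred A
            g⁻¹g₀z∈A = proj₂ (proj₂ z-escaping)

          Z : Subset setoid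
          Z .pred y = Lift c (∃ λ n → y ≈ z n)
          Z .resp x≈y (lift (n , x≈zn)) = lift (n , trans (sym x≈y) x≈zn)

          Z⊆A : pred Z ⊆ pred A
          Z⊆A (lift (n , y≈zn)) = resp A (sym y≈zn) (z∈A n)

          Z-unbounded : ¬ Bounded G A Z
          Z-unbounded (inj₁ Z-empty) = Z-empty (z 0) (lift (0 , refl))
          Z-unbounded (inj₂ (a , _ , R , Z⊆B)) with z-unbounded (map (_∙ a) (ε ∷ proj₁ (proj₂ R)))
          ... | n , zn∉ = zn∉ (ball⇒∈-map R (proj₂ (Z⊆B {z n} (lift (n , refl)))))

          -- Some `z m` lies outside the finitely many `f ∙ z n`; the quotient of `z m` by `z n` is
          -- then as required.
          escape : ∀ fs n → ∃ λ h → h ∉ₗ fs × h ∙ z n ∈ pred A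
          escape fs n with z-unbounded (map (_∙ z n) fs)
          ... | m , zm∉ = z m ∙ z n ⁻¹ ,
            (λ h∈fs → zm∉ (Membershipₚ.∈-resp-≈ setoid (//-rightDividesˡ (z n) (z m)) (∈-map⁺ ∙-congʳ h∈fs))) ,
            resp A (sym (//-rightDividesˡ (z n) (z m))) (z∈A m)

          -- One `h = g ⁻¹ ∙ g₀` serves all `n` from the index of `g` on, and each of the finitely
          -- many earlier terms gets its own `escape`. Choosing `g` outside the elements `g₀ ∙ f ⁻¹`
          -- keeps `h` out of `fs`.
          uniformEscape : ∀ fs → ∃ λ hs → ∀ n → ∃ λ h → h ∈ₗ hs × h ∉ₗ fs × h ∙ z n ∈ pred A
          uniformEscape fs with infinite⇒∃∉ em Y Y-infinite (map (λ f → g₀ ∙ f ⁻¹) fs)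
          ... | g , g∈Y , g∉ = g ⁻¹ ∙ g₀ ∷ applyUpTo late (index g) , witness
            where
            late : ℕ → Carrier
            late n = proj₁ (escape fs n)

            g≈g₀h⁻¹ : g ≈ g₀ ∙ (g ⁻¹ ∙ g₀) ⁻¹
            g≈g₀h⁻¹ = sym (begin
              g₀ ∙ (g ⁻¹ ∙ g₀) ⁻¹      ≈⟨ ∙-congˡ (⁻¹-anti-homo-∙ (g ⁻¹) g₀) ⟩
              g₀ ∙ (g₀ ⁻¹ ∙ g ⁻¹ ⁻¹)   ≈⟨ \\-leftDividesˡ g₀ (g ⁻¹ ⁻¹) ⟩
              g ⁻¹ ⁻¹                  ≈⟨ ⁻¹-involutive g ⟩
              g                        ∎)
              where open ≈-Reasoning setoid

            witness : ∀ n → ∃ λ h → h ∈ₗ g ⁻¹ ∙ g₀ ∷ applyUpTo late (index g) ×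
                                    h ∉ₗ fs × h ∙ z n ∈ pred A
            witness n with <-≤-connex n (index g)
            ... | inj₁ n<i = late n , there (Membershipₚ.∈-applyUpTo⁺ setoid late n<i) , proj₂ (escape fs n)
            ... | inj₂ i≤n = g ⁻¹ ∙ g₀ , here refl ,
              (λ h∈fs → g∉ (Membershipₚ.∈-resp-≈ setoid (sym g≈g₀h⁻¹) (∈-map⁺ (∙-congˡ ∘ ⁻¹-cong) h∈fs))) ,
              g⁻¹g₀z∈A g∈Y i≤n

          Z-notIsolated : ¬ HasAsymptoticallyIsolatedBalls G A Z
          Z-notIsolated (R@(_ , fs , R⊆fs , _) , isolated)
            -- Avoiding `ε` as well as `fs` keeps `h ∙ y` away from the centre `y`. Appending `fs`
            -- to `hs` makes the new radius larger than `R`.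
            with hs , escapes ← uniformEscape (ε ∷ fs)
            with isolated (listRadius (hs ++ fs)) (λ a a∈A → λ where
                   (y∈A , inj₁ (f , f∈R , y≈fa)) →
                     y∈A , inj₁ (f , Membershipₚ.∈-++⁺ʳ setoid hs (R⊆fs f∈R) , y≈fa)
                   (y∈A , inj₂ y≈a) → y∈A , inj₂ y≈a)
          ... | y , lift (n , y≈zn) , ball∖ball-empty
            with h , h∈hs , h∉fs , hzn∈A ← escapes n =
            ball∖ball-empty (h ∙ y)
              ( (hy∈A , inj₁ (h , Membershipₚ.∈-++⁺ˡ setoid h∈hs , refl))
              , λ (_ , hy∈B) → h∉fs (∈-map⇒∈ h y (ball⇒∈-map R hy∈B)))
            where
            hy∈A : h ∙ y ∈ pred A
            hy∈A = resp A (∙-congˡ (sym y≈zn)) hzn∈A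

      scattered⇒sparse : Countable setoid → AsymptoticallyScattered G A → Sparse G A
      -- `EM` at the higher level is called for, as the negated statement quantifies over subsets.
      scattered⇒sparse countable scattered Y Y-infinite = decidable-stable EM λ ∄F →
        let g₀ , z , z-escaping = escapingSequence countable Y Y-infinite
              (λ F F-finite F⊆Y ⋂-finite → ∄F (F , F-finite , (λ {x} → F⊆Y {x}) , ⋂-finite))
            open SequenceRange countable Y Y-infinite z-escaping
        in Z-notIsolated (scattered Z Z⊆A Z-unbounded)

      -- From sparse to finitely many translates of an ultrafilter.

      sparse⇒finitelyMany : Sparse G A → FinitelyManyTranslatesContain G A
      sparse⇒finitelyMany sparse 𝓤 isUltrafilter free _ = decidable-stable EM S-finite
        where
        open IsUltrafilter isUltrafilter

        S : Pred Carrier (suc (c ⊔ ℓ))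
        S g = A ∈ translateFamily G g 𝓤

        S-resp : S Respects _≈_
        S-resp g≈h g∈S = preimage∈⇒∈translateFamily
          (upward (preimage-cong A g≈h) (∈translateFamily⇒preimage∈ isFilter g∈S))

        -- {g | gA ∈ 𝓤}; the decision True (EM …) lowers its universe level.
        Y : Subset setoid
        Y .pred g = Lift (c ⊔ ℓ) (True (EM {S (g ⁻¹)}))
        Y .resp g≈h (lift g∈Y) = lift (fromWitness (S-resp (⁻¹-cong g≈h) (toWitness g∈Y)))

        -- Inversion carries `Y` onto `S`, so a list covering `Y` would give one covering `S`.
        Y-infinite : Infinite setoid S → Infinite setoid (pred Y)
        Y-infinite S-infinite (ys , Y⊆ys , _) = S-infinite
          (decidable-⊆-finite {S = setoid} (λ _ → EM) S-resp {map _⁻¹ ys} λ {g} g∈S →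
            Membershipₚ.∈-resp-≈ setoid (⁻¹-involutive g) (∈-map⁺ ⁻¹-cong
              (Y⊆ys (lift (fromWitness (S-resp (sym (⁻¹-involutive g)) g∈S))))))

        S-finite : ¬ Infinite setoid S
        S-finite S-infinite with sparse Y (Y-infinite S-infinite)
        ... | F , (fs , F⊆fs , fs⊆F) , F⊆Y , ⋂-finite =
          -- Since `fs` lists elements of `Y`, the translates of `A` by its entries are in `𝓤`, and
          -- so is their finite intersection.
          free⇒∌finite isUltrafilter em free {translates∩ F}
            (upward ⋂ˢ⊆ (⋂-closed isFilter (λ g → preimage (g ⁻¹) A) fs
              (All.tabulateₛ setoid λ g∈fs →
                ∈translateFamily⇒preimage∈ isFilter (toWitness (lower (F⊆Y (fs⊆F g∈fs)))))))
            ⋂-finite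
          where
          ⋂ˢ⊆ : pred (⋂ˢ (λ g → preimage (g ⁻¹) A) fs) ⊆ pred (translates∩ F)
          ⋂ˢ⊆ x∈⋂ g g∈F = preimage⇒leftTranslate A
            (All.lookupₛ setoid (λ g≈h → preimage-cong A (⁻¹-cong g≈h)) x∈⋂ (F⊆fs g∈F))

      -- From finitely many translates to scattered.

      finitelyMany⇒scattered : UltrafilterLemma c ℓ →
                               FinitelyManyTranslatesContain G A → AsymptoticallyScattered G A
      finitelyMany⇒scattered ul finitelyMany Y Y⊆A Y-unbounded
        with 𝓤 , isUltrafilter , cofinite⊆𝓤 ← ul setoid (cofiniteOn Y)
               (cofiniteOn-isFilter Y λ _ → Y-unbounded ∘ list⊇⇒bounded em Y Y⊆A)
        with ss , S⊆ss , _ ← finitelyMany 𝓤 isUltrafilter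
               (⊇cofiniteOn⇒free em Y (IsUltrafilter.isFilter isUltrafilter) cofinite⊆𝓤)
               (cofinite⊆𝓤 (lift ([] , inj₂ ∘ Y⊆A)))
        = F , λ H _ → decidable-stable em (isolated H)
        where
        open IsUltrafilter isUltrafilter

        F : Radius G
        F = listRadius ss

        -- The condition `h ∉ₗ ss` does not involve `y`: it makes `Q h` empty for `h` in `ss`, so
        -- that primeness can be applied to all of `hs` without first removing those `h`.
        Q : Carrier → Subset setoid
        Q h .pred y = h ∉ₗ ss × h ∙ y ∈ pred A
        Q h .resp x≈y (h∉ss , hx∈A) = h∉ss , resp (preimage h A) x≈y hx∈A

        Q∉𝓤 : ∀ h → Q h ∉ 𝓤
        Q∉𝓤 h Qh∈𝓤 = proper (upward (λ (h∉ss , _) → ⊥-elim (h∉ss h∈ss)) Qh∈𝓤)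
          where
          h∈ss : h ∈ₗ ss
          h∈ss = S⊆ss (preimage∈⇒∈translateFamily (upward proj₂ Qh∈𝓤))

        isolated : ∀ H → ¬ ¬ (∃ λ y → y ∈ pred Y ×
                   Empty (inducedBall G A y H ∖ inducedBall G A y F))
        isolated H@(_ , hs , H⊆hs , _) ∄y =
          let h , Qh∈𝓤 = Any.satisfied (⋃-prime isUltrafilter Q hs Y∈𝓤 Y⊆⋃) in Q∉𝓤 h Qh∈𝓤
          where
          Y∈𝓤 : Y ∈ 𝓤
          Y∈𝓤 = cofinite⊆𝓤 (lift ([] , inj₂))

          Y⊆⋃ : ∀ {y} → y ∈ pred Y → Any (λ h → y ∈ pred (Q h)) hs
          -- If no `Q h` contained `y`, its two balls would agree: a point of the `H`-ball outside
          -- the `F`-ball is not the centre, so it is `h ∙ y` with `h` from `H` and not in `ss`.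
          Y⊆⋃ {y} y∈Y = decidable-stable em λ y∉⋃ → ∄y (y , y∈Y , λ where
            z ((z∈A , inj₂ z≈y) , z∉B) → z∉B (z∈A , inj₂ z≈y)
            z ((z∈A , inj₁ (h , h∈H , z≈hy)) , z∉B) → y∉⋃
              (Any.map (λ {h′} h≈h′ →
                  (λ h′∈ss → z∉B (z∈A , inj₁ (h′ , h′∈ss , trans z≈hy (∙-congʳ h≈h′)))) ,
                  resp A (trans z≈hy (∙-congʳ h≈h′)) z∈A)
                (H⊆hs h∈H)))

theorem10 : ∀ {c ℓ} → ExcludedMiddle (suc (c ⊔ ℓ)) → UltrafilterLemma c ℓ →
    (G : Group c ℓ) → Countable (Group.setoid G) → (A : Subset (Group.setoid G)) →
    (AsymptoticallyScattered G A ⇔ Sparse G A) ×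
    (Sparse G A ⇔ FinitelyManyTranslatesContain G A)
theorem10 EM ul G countable A =
  mk⇔ i⇒ii (iii⇒i ∘ ii⇒iii) , mk⇔ ii⇒iii (i⇒ii ∘ iii⇒i)
  where
  i⇒ii : AsymptoticallyScattered G A → Sparse G A
  i⇒ii = scattered⇒sparse G A EM countable

  ii⇒iii : Sparse G A → FinitelyManyTranslatesContain G A
  ii⇒iii = sparse⇒finitelyMany G A EM

  iii⇒i : FinitelyManyTranslatesContain G A → AsymptoticallyScattered G A
  iii⇒i = finitelyMany⇒scattered G A EM ul
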